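{- Let $A$ be a finite set with $|A|\geq 7$ and let $n$ be a positive integer. If a path on vertex set $\{0,\ldots,n-1\}$ generates $\mathrm{Eq}_n(A)$, then this path contains an edge $\{i,i+1\}$ between two consecutive positions.
   Context: All sets are finite (possibly empty). For $f:B^J\to A^I$ write $f_i(x)=f(x)_i$. For $i\in I$, the input window $\mathcal{W}_f(i)$ is the smallest set $W\subseteq J$ (it exists) such that for all $x,y\in B^J$, $x|_W=y|_W$ implies $f_i(x)=f_i(y)$. A simplicial complex (or complex) over $I$ is a collection of subsets of $I$ (its simplices) closed under taking subsets; the empty set is a simplex of every complex. The communication complex $K_f$ of $f$ is the complex over $I$ in which a non-empty $S\subseteq I$ is a simplex iff $\bigcap_{i\in S}\mathcal{W}_f(i)\neq\emptyset$. A complex $K$ over $I$ generates a language $L\subseteq A^I$ if there exist finite sets $B,J$ and a function $f:B^J\to A^I$ with image exactly $L$ and $K_f\subseteq K$. $\mathrm{Eq}_n(A)\subseteq A^n=A^{\{0,\ldots,n-1\}}$ is the set of strings $w$ such that $w_i=w_{i+1}$ for some $i$ with $0\le i<n-1$. A path on $\{0,\ldots,n-1\}$ is a spanning tree consisting of one root, one leaf (distinct from the root, so $n\geq 2$) and a single branch between them, i.e. for some ordering $v_0,\ldots,v_{n-1}$ of $\{0,\ldots,n-1\}$ its edges are $\{v_j,v_{j+1}\}$ for $0\le j<n-1$. It is regarded as a complex whose simplices are $\emptyset$, the singletons and its edges. -}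

module Defs where

open import Data.Nat using (ℕ; zero; suc; _≤_)
open import Data.Fin using (Fin; toℕ)
import Data.Fin as Fin
import Data.Fin.Properties as Fin
open import Data.Fin.Permutation using (Permutation′; _⟨$⟩ʳ_)
open import Data.Fin.Subset
open import Data.Fin.Subset.Properties
open import Data.List using (List; []; _∷_; allFin)
import Data.List.Membership.Propositional as List
open import Data.List.Membership.Propositional.Properties using (∈-allFin)
open import Data.List.Relation.Unary.Any using (here; there)
open import Data.Product using (∃; ∃₂; Σ-syntax; ∃-syntax; _×_; _,_; proj₁)
open import Data.Sum using (_⊎_; inj₁; inj₂)
import Data.Vec
open import Data.Vec using (Vec; []; _∷_; lookup; tabulate)
open import Data.Vec.Properties using (lookup∘tabulate)
open import Function using (_∘_; _↔_; _⇔_; Inverse)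
open import Function.Properties.Inverse using (↔⇒↣)
open import Level using (0ℓ)
open import Relation.Binary.Definitions using (DecidableEquality)
open import Relation.Binary.PropositionalEquality
  using (_≡_; refl; sym; trans; subst; cong₂)
open import Relation.Nullary using (¬_; Dec; yes; no; contradiction)
open import Relation.Nullary.Decidable using (map′; via-injection; _→-dec_)
open import Relation.Unary using (Pred; Decidable)

-- Finite index sets are the sets Fin m, so that Bᴶ is Vec B m with J = Fin m
-- and subsets of J are Subset m.

Agree : ∀ {B : Set} {m} → Subset m → Vec B m → Vec B m → Set
Agree W x y = ∀ {j} → j ∈ W → lookup x j ≡ lookup y j

Determines : ∀ {A B : Set} {m n} → (Vec B m → Vec A n) → Fin n → Subset m → Set
Determines f i W = ∀ x y → Agree W x y → lookup (f x) i ≡ lookup (f y) i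

IsInputWindow : ∀ {A B : Set} {m n} → (Vec B m → Vec A n) → Fin n → Subset m → Set
IsInputWindow f i W = Determines f i W × (∀ W′ → Determines f i W′ → W ⊆ W′)

-- The window exists whenever A and B are finite (see inputWindow below) and is
-- unique, so membership in it can be stated through any set satisfying its
-- specification.
InWindow : ∀ {A B : Set} {m n} → (Vec B m → Vec A n) → Fin n → Fin m → Set
InWindow f i j = ∃[ W ] IsInputWindow f i W × j ∈ W

record Complex (n : ℕ) : Set₁ where
  field
    Simplex : Pred (Subset n) 0ℓ
    ∅-simplex : Simplex ⊥
    ⊆-closed : ∀ {S T} → S ⊆ T → Simplex T → Simplex S

open Complex public

infix 4 _⊑_

_⊑_ : ∀ {n} → Complex n → Complex n → Set
K ⊑ L = ∀ S → Simplex K S → Simplex L S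

communicationComplex : ∀ {A B : Set} {m n} → (Vec B m → Vec A n) → Complex n
communicationComplex f = record
  { Simplex   = λ S → Nonempty S → ∃[ j ] (∀ {i} → i ∈ S → InWindow f i j)
  ; ∅-simplex = λ (_ , i∈⊥) → contradiction i∈⊥ ∉⊥
  ; ⊆-closed  = λ S⊆T simplexT (i , i∈S) →
      let j , common = simplexT (i , S⊆T i∈S) in j , λ i′∈S → common (S⊆T i′∈S)
  }

Language : Set → ℕ → Set₁
Language A n = Pred (Vec A n) 0ℓ

HasImage : ∀ {A B : Set} {m n} → (Vec B m → Vec A n) → Language A n → Set
HasImage f L = ∀ w → L w ⇔ ∃ λ x → f x ≡ w

Generates : ∀ {A : Set} {n} → Complex n → Language A n → Set₁
Generates {A} {n} K L =
  Σ[ B ∈ Set ] Σ[ b ∈ ℕ ] (B ↔ Fin b) ×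
  (Σ[ m ∈ ℕ ] Σ[ f ∈ (Vec B m → Vec A n) ]
    HasImage f L × communicationComplex f ⊑ K)

Consecutive : ∀ {n} → Fin n → Fin n → Set
Consecutive i j = toℕ j ≡ suc (toℕ i)

Eq : ∀ n (A : Set) → Language A n
Eq n A w = ∃₂ λ i j → Consecutive i j × lookup w i ≡ lookup w j

record Path (n : ℕ) : Set where
  field
    2≤n : 2 ≤ n
    ordering : Permutation′ n

  vertex : Fin n → Fin n
  vertex j = ordering ⟨$⟩ʳ j

  Edge : Subset n → Set
  Edge S = ∃₂ λ j k → Consecutive j k × S ≡ ⁅ vertex j ⁆ ∪ ⁅ vertex k ⁆

open Path public using (Edge)

private
  ⊆⁅⁆ : ∀ {n} {S : Subset n} u → S ⊆ ⁅ u ⁆ → S ≡ ⊥ ⊎ S ≡ ⁅ u ⁆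
  ⊆⁅⁆ {S = S} u S⊆ with u ∈? S
  ... | yes u∈S = inj₂ (⊆-antisym S⊆ λ x∈ → subst (_∈ S) (sym (x∈⁅y⁆⇒x≡y u x∈)) u∈S)
  ... | no  u∉S = inj₁ (Empty-unique λ (x , x∈S) →
                    u∉S (subst (_∈ S) (x∈⁅y⁆⇒x≡y u (S⊆ x∈S)) x∈S))

  ⊆pair : ∀ {n} {S : Subset n} u v → S ⊆ ⁅ u ⁆ ∪ ⁅ v ⁆ →
          S ≡ ⊥ ⊎ (∃[ i ] S ≡ ⁅ i ⁆) ⊎ S ≡ ⁅ u ⁆ ∪ ⁅ v ⁆
  ⊆pair {S = S} u v S⊆ with u ∈? S | v ∈? S
  ... | yes u∈S | yes v∈S = inj₂ (inj₂ (⊆-antisym S⊆ back))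
    where
    back : ⁅ u ⁆ ∪ ⁅ v ⁆ ⊆ S
    back x∈ with x∈p∪q⁻ ⁅ u ⁆ ⁅ v ⁆ x∈
    ... | inj₁ x∈u = subst (_∈ S) (sym (x∈⁅y⁆⇒x≡y u x∈u)) u∈S
    ... | inj₂ x∈v = subst (_∈ S) (sym (x∈⁅y⁆⇒x≡y v x∈v)) v∈S
  ... | no u∉S | _ with ⊆⁅⁆ v only-v
    where
    only-v : S ⊆ ⁅ v ⁆
    only-v x∈S with x∈p∪q⁻ ⁅ u ⁆ ⁅ v ⁆ (S⊆ x∈S)
    ... | inj₁ x∈u = contradiction (subst (_∈ S) (x∈⁅y⁆⇒x≡y u x∈u) x∈S) u∉S
    ... | inj₂ x∈v = x∈v
  ...   | inj₁ S≡⊥ = inj₁ S≡⊥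
  ...   | inj₂ S≡v = inj₂ (inj₁ (v , S≡v))
  ⊆pair {S = S} u v S⊆ | yes _ | no v∉S with ⊆⁅⁆ u only-u
    where
    only-u : S ⊆ ⁅ u ⁆
    only-u x∈S with x∈p∪q⁻ ⁅ u ⁆ ⁅ v ⁆ (S⊆ x∈S)
    ... | inj₁ x∈u = x∈u
    ... | inj₂ x∈v = contradiction (subst (_∈ S) (x∈⁅y⁆⇒x≡y v x∈v) x∈S) v∉S
  ...   | inj₁ S≡⊥ = inj₁ S≡⊥
  ...   | inj₂ S≡u = inj₂ (inj₁ (u , S≡u))

pathComplex : ∀ {n} → Path n → Complex n
pathComplex {n} P = record
  { Simplex   = PathSimplex
  ; ∅-simplex = inj₁ refl
  ; ⊆-closed  = closed
  }
  where
  PathSimplex : Pred (Subset n) 0ℓ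
  PathSimplex S = S ≡ ⊥ ⊎ (∃[ i ] S ≡ ⁅ i ⁆) ⊎ Edge P S

  closed : ∀ {S T} → S ⊆ T → PathSimplex T → PathSimplex S
  closed S⊆T (inj₁ refl) = inj₁ (⊆-antisym S⊆T ⊥⊆)
  closed S⊆T (inj₂ (inj₁ (i , refl))) with ⊆⁅⁆ i S⊆T
  ... | inj₁ S≡⊥ = inj₁ S≡⊥
  ... | inj₂ S≡i = inj₂ (inj₁ (i , S≡i))
  closed S⊆T (inj₂ (inj₂ (j , k , jk , refl))) with ⊆pair _ _ S⊆T
  ... | inj₁ S≡⊥        = inj₁ S≡⊥
  ... | inj₂ (inj₁ S≡i) = inj₂ (inj₁ S≡i)
  ... | inj₂ (inj₂ S≡e) = inj₂ (inj₂ (j , k , jk , S≡e))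

allVec? : ∀ {B : Set} {b m} → B ↔ Fin b → {P : Pred (Vec B m) 0ℓ} →
          Decidable P → Dec (∀ x → P x)
allVec? {m = zero}  e P? = map′ (λ p → λ { [] → p }) (λ p → p []) (P? [])
allVec? {m = suc m} e {P} P? =
  map′ (λ p → λ { (x ∷ xs) → subst (λ z → P (z ∷ xs)) (Inverse.strictlyInverseʳ e x)
                                (p (Inverse.to e x) xs) })
       (λ p k xs → p (Inverse.from e k ∷ xs))
       (Fin.all? λ k → allVec? e λ xs → P? (Inverse.from e k ∷ xs))

module _ {A B : Set} {a b m n : ℕ} (eA : A ↔ Fin a) (eB : B ↔ Fin b)
         (f : Vec B m → Vec A n) (i : Fin n) where

  private
    _≟A_ : DecidableEquality A
    _≟A_ = via-injection (↔⇒↣ eA) Fin._≟_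

    _≟B_ : DecidableEquality B
    _≟B_ = via-injection (↔⇒↣ eB) Fin._≟_

    determines? : Decidable (Determines f i)
    determines? W = allVec? eB λ x → allVec? eB λ y →
      map′ (λ h {j} → h j) (λ h j → h {j})
           (Fin.all? λ j → (j ∈? W) →-dec (lookup x j ≟B lookup y j))
      →-dec (lookup (f x) i ≟A lookup (f y) i)

    Vec-ext : ∀ {k} {x y : Vec B k} → (∀ j → lookup x j ≡ lookup y j) → x ≡ y
    Vec-ext {x = []}    {[]}    h = refl
    Vec-ext {x = _ ∷ _} {_ ∷ _} h = cong₂ _∷_ (h Fin.zero) (Vec-ext (h ∘ Fin.suc))

    ⊤-determines : Determines f i ⊤
    ⊤-determines x y h with refl ← Vec-ext {x = x} {y} (λ _ → h ∈⊤) = refl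

    ⊆-determines : ∀ {V W} → V ⊆ W → Determines f i V → Determines f i W
    ⊆-determines V⊆W d x y h = d x y (h ∘ V⊆W)

    ∩-determines : ∀ {V W} → Determines f i V → Determines f i W → Determines f i (V ∩ W)
    ∩-determines {V} {W} dV dW x y h = trans (dV x z x~z) (dW z y z~y)
      where
      glue : Fin m → B
      glue j with j ∈? V
      ... | yes _ = lookup x j
      ... | no  _ = lookup y j

      z : Vec B m
      z = tabulate glue

      x~z : Agree V x z
      x~z {j} j∈V rewrite lookup∘tabulate glue j with j ∈? V
      ... | yes _  = refl
      ... | no j∉V = contradiction j∈V j∉V

      z~y : Agree W z y
      z~y {j} j∈W rewrite lookup∘tabulate glue j with j ∈? V
      ... | yes j∈V = h (x∈p∩q⁺ (j∈V , j∈W))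
      ... | no _    = refl

    prune : (js : List (Fin m)) → ∃[ W ] Determines f i W ×
            (∀ {j} → j List.∈ js → j ∈ W → ¬ Determines f i (⊤ - j))
    prune [] = ⊤ , ⊤-determines , λ ()
    prune (j ∷ js) with prune js | determines? (⊤ - j)
    ... | W , d , h | no ¬d = W , d , λ { (here refl) _ → ¬d ; (there k) → h k }
    ... | W , d , h | yes d′ = (⊤ - j) ∩ W , ∩-determines d′ d , λ
      { (here refl) j∈ → contradiction (proj₁ (x∈p∩q⁻ (⊤ - j) W j∈)) (j∉⊤-j j)
      ; (there k)   j∈ → h k (p∩q⊆q (⊤ - j) W j∈) }
      where
      j∉⊤-j : ∀ {k} (j : Fin k) → ¬ j ∈ ⊤ - j
      j∉⊤-j Fin.zero    ()
      j∉⊤-j (Fin.suc j) (Data.Vec.there j∈) = j∉⊤-j j j∈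

  inputWindow : ∃[ W ] IsInputWindow f i W
  inputWindow with prune (allFin m)
  ... | W , d , h = W , d , least
    where
    least : ∀ W′ → Determines f i W′ → W ⊆ W′
    least W′ d′ {j} j∈W with j ∈? W′
    ... | yes j∈W′ = j∈W′
    ... | no  j∉W′ = contradiction
      (⊆-determines (λ {k} k∈W′ → x∈p∧x≢y⇒x∈p-y ∈⊤ λ { refl → j∉W′ k∈W′ }) d′)
      (h (∈-allFin j) j∈W)

{-# OPTIONS --safe #-}
module Submission where

-- Order the positions by their rank along the path.  An input coordinate is
-- shared only by positions of consecutive ranks, so at every cut "ranks ≤ k"
-- versus "ranks > k" two inputs agreeing on the coordinates shared across the
-- cut can be glued.  Assume no path edge is consecutive and let k run down from
-- n - 1.  We maintain an input y such that every x′ agreeing with y on the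
-- coordinates shared at cut k has, on ranks ≤ k, two equal consecutive letters,
-- or a letter from a small forbidden set at a position of rank < k.  At k = 0
-- the input y itself contradicts this.
--
-- To go from k + 1 to k, let u and v have ranks k and k + 1, and pick a letter
-- not forbidden at u.  The word equal to that letter on u and its neighbours and
-- alternating elsewhere is in the language, but its part of rank > k contains
-- no equality.  An input x of it is the next input: gluing x′ with x forces the
-- letter at u to be the new one, while gluing x′ with y forces the letter at u
-- to be a forbidden one.  At most six letters are forbidden at u.

open import Data.Nat using (ℕ; zero; suc; _≤_; _<_; _∸_; z≤n; s≤s)
import Data.Nat.Properties as ℕ
open import Data.Fin using (Fin; zero; suc; toℕ; fromℕ<; inject₁)
import Data.Fin.Properties as Fin
open import Data.Fin.Permutation using (Permutation′; _⟨$⟩ʳ_; _⟨$⟩ˡ_; inverseˡ; inverseʳ)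
open import Data.Fin.Subset using (Subset; ⁅_⁆; _∪_; _∈_)
open import Data.Fin.Subset.Properties
  using (_∈?_; x∈⁅x⁆; x∈⁅y⁆⇒x≡y; x∈p∪q⁻; x∈p∪q⁺; ∪-comm; ∉⊥)
open import Data.Empty using (⊥; ⊥-elim)
open import Data.Product using (∃; ∃₂; ∃-syntax; _×_; _,_; proj₁; proj₂)
open import Data.Sum using (_⊎_; inj₁; inj₂; swap)
open import Data.Vec using (Vec; []; _∷_; lookup; tabulate)
open import Data.Vec.Properties using (lookup∘tabulate)
open import Function using (_∘_; _↔_; Inverse; Injection; Equivalence)
open import Function.Properties.Inverse using (↔⇒↣; ↔-sym)
open import Relation.Binary.Definitions using (DecidableEquality)
open import Relation.Binary.PropositionalEquality
  using (_≡_; _≢_; refl; sym; trans; cong; cong₂; subst; ≢-sym)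
open import Relation.Nullary using (¬_; Dec; yes; no; contradiction)
open import Relation.Nullary.Decidable
  using (via-injection; decidable-stable; ¬?; _×-dec_; _⊎-dec_)
open import Relation.Unary using (Decidable)
open import Defs

-- Fresh letters in a finite alphabet.

module _ {A : Set} {a : ℕ} (eA : A ↔ Fin a) where

  ≟-finite : DecidableEquality A
  ≟-finite = via-injection (↔⇒↣ eA) Fin._≟_

  fresh : ∀ {m} → m < a → (xs : Vec A m) → ∃[ x ] ∀ i → x ≢ lookup xs i
  fresh m<a xs with Fin.any? (λ k → Fin.all? (λ i → ¬? (≟-finite (Inverse.from eA k) (lookup xs i))))
  ... | yes (k , k∉xs) = Inverse.from eA k , k∉xs
  ... | no all-listed  =
    let i , j , i<j , same = Fin.pigeonhole m<a (proj₁ ∘ listed)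
        i≡j = Injection.injective (↔⇒↣ (↔-sym eA))
                (trans (proj₂ (listed i))
                  (trans (cong (lookup xs) same) (sym (proj₂ (listed j)))))
    in contradiction i≡j (Fin.<⇒≢ i<j)
    where
    listed : ∀ k → ∃[ i ] Inverse.from eA k ≡ lookup xs i
    listed k = decidable-stable (Fin.any? λ i → ≟-finite (Inverse.from eA k) (lookup xs i))
      λ ¬p → all-listed (k , λ i eq → ¬p (i , eq))

-- Neighbouring positions of a word.

Adjacent : ∀ {n} → Fin n → Fin n → Set
Adjacent s t = Consecutive s t ⊎ Consecutive t s

consecutive? : ∀ {n} (s t : Fin n) → Dec (Consecutive s t)
consecutive? s t = toℕ t ℕ.≟ suc (toℕ s)

neighbour : ∀ {n} → 2 ≤ n → (s : Fin n) → ∃[ t ] Adjacent s t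
neighbour (s≤s (s≤s _)) zero    = suc zero , inj₁ refl
neighbour _             (suc s) = inject₁ s , inj₂ (cong suc (sym (Fin.toℕ-inject₁ s)))

Adjacent-position : ∀ {n} {s t : Fin n} → Adjacent s t → toℕ t ≡ suc (toℕ s) ⊎ toℕ t ≡ toℕ s ∸ 1
Adjacent-position (inj₁ t≡1+s) = inj₁ t≡1+s
Adjacent-position (inj₂ s≡1+t) = inj₂ (sym (cong (_∸ 1) s≡1+t))

-- Two steps that do not turn back go the same way. Hence at most two positions can spread a letter
-- to a given one.
Adjacent²-position : ∀ {n} {s t t′ : Fin n} → Adjacent s t → Adjacent t t′ → t′ ≢ s →
                     toℕ t′ ≡ suc (suc (toℕ s)) ⊎ toℕ t′ ≡ toℕ s ∸ 2
Adjacent²-position (inj₁ t≡1+s) (inj₁ t′≡1+t) _ = inj₁ (trans t′≡1+t (cong suc t≡1+s))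
Adjacent²-position (inj₁ t≡1+s) (inj₂ t≡1+t′) t′≢s =
  contradiction (Fin.toℕ-injective (ℕ.suc-injective (trans (sym t≡1+t′) t≡1+s))) t′≢s
Adjacent²-position (inj₂ s≡1+t) (inj₁ t′≡1+t) t′≢s =
  contradiction (Fin.toℕ-injective (trans t′≡1+t (sym s≡1+t))) t′≢s
Adjacent²-position (inj₂ s≡1+t) (inj₂ t≡1+t′) _ =
  inj₂ (sym (cong (_∸ 2) (trans s≡1+t (cong suc t≡1+t′))))

-- Neighbours have opposite parity. So the two neighbours of `u`, which will carry the same letter,
-- create no equality.
¬Adjacent-triangle : ∀ {n} {s t u : Fin n} → Consecutive s t → Adjacent s u → ¬ Adjacent t u
¬Adjacent-triangle st (inj₁ su) (inj₁ tu) =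
  ℕ.1+n≢n (sym (trans (trans (sym su) tu) (cong suc st)))
¬Adjacent-triangle st (inj₁ su) (inj₂ ut) =
  ℕ.1+n≢n (sym (trans (ℕ.suc-injective (trans (sym st) ut)) su))
¬Adjacent-triangle st (inj₂ us) (inj₁ tu) =
  ℕ.<-asym (ℕ.<-trans (ℕ.≤-reflexive (sym st)) (ℕ.≤-reflexive (sym tu))) (ℕ.≤-reflexive (sym us))
¬Adjacent-triangle st (inj₂ us) (inj₂ ut) =
  ℕ.1+n≢n (sym (trans (ℕ.suc-injective (trans (sym ut) st)) us))

-- Letter tables and the alternating colouring.

_[_↦_] : {A : Set} → (ℕ → A) → ℕ → A → ℕ → A
(g [ p ↦ x ]) q with p ℕ.≟ q
... | yes _ = x
... | no  _ = g q

↦-updates : ∀ {A : Set} (g : ℕ → A) p x → (g [ p ↦ x ]) p ≡ x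
↦-updates g p x with p ℕ.≟ p
... | yes _  = refl
... | no p≢p = contradiction refl p≢p

↦-minimal : ∀ {A : Set} (g : ℕ → A) {p q} x → p ≢ q → (g [ p ↦ x ]) q ≡ g q
↦-minimal g {p} {q} x p≢q with p ℕ.≟ q
... | yes p≡q = contradiction p≡q p≢q
... | no  _   = refl

module _ {A : Set} (h₀ h₁ : A) where

  alternating : ℕ → A
  alternating zero          = h₀
  alternating (suc zero)    = h₁
  alternating (suc (suc p)) = alternating p

  alternating-value : ∀ p → alternating p ≡ h₀ ⊎ alternating p ≡ h₁
  alternating-value zero          = inj₁ refl
  alternating-value (suc zero)    = inj₂ refl
  alternating-value (suc (suc p)) = alternating-value p

  alternating-≢ : h₀ ≢ h₁ → ∀ p → alternating p ≢ alternating (suc p)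
  alternating-≢ h₀≢h₁ zero          = h₀≢h₁
  alternating-≢ h₀≢h₁ (suc zero)    = ≢-sym h₀≢h₁
  alternating-≢ h₀≢h₁ (suc (suc p)) = alternating-≢ h₀≢h₁ p

-- Ranks along an ordering of the positions.

module _ {n : ℕ} (π : Permutation′ n) where

  rank : Fin n → ℕ
  rank s = toℕ (π ⟨$⟩ˡ s)

  rank<n : ∀ s → rank s < n
  rank<n s = Fin.toℕ<n (π ⟨$⟩ˡ s)

  rank-injective : ∀ {s t} → rank s ≡ rank t → s ≡ t
  rank-injective eq =
    trans (sym (inverseʳ π)) (trans (cong (π ⟨$⟩ʳ_) (Fin.toℕ-injective eq)) (inverseʳ π))

  atRank : ∀ {k} → k < n → ∃[ s ] rank s ≡ k
  atRank k<n = π ⟨$⟩ʳ fromℕ< k<n , trans (cong toℕ (inverseˡ π)) (Fin.toℕ-fromℕ< k<n)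

-- The descent along the cuts.

module Descent
  {A B : Set} {a m n : ℕ} (eA : A ↔ Fin a) (7≤a : 7 ≤ a) (2≤n : 2 ≤ n)
  (h₀ h₁ : A) (h₀≢h₁ : h₀ ≢ h₁)
  (π : Permutation′ n) (f : Vec B m → Vec A n) (image : HasImage f (Eq n A))
  (W : Fin n → Subset m) (determines : ∀ s → Determines f s (W s))
  -- `local` will come from the inclusion of complexes, `apart` from the assumption that no path
  -- edge is consecutive.
  (local : ∀ {s t j} → j ∈ W s → j ∈ W t → rank π t ≤ suc (rank π s))
  (apart : ∀ {s t} → Adjacent s t → rank π t ≢ suc (rank π s))
  where

  ρ : Fin n → ℕ
  ρ = rank π

  h : ℕ → A
  h = alternating h₀ h₁

  f∈Eq : ∀ x → Eq n A (f x)
  f∈Eq x = Equivalence.from (image (f x)) (x , refl)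

  -- No field fixes the letter at `u`: the word is used only above a cut that has `u` below it.
  record Spread (w : Vec A n) (λ₀ : A) (u : Fin n) : Set where
    field
      near : ∀ {t} → Adjacent t u → lookup w t ≡ λ₀
      far  : ∀ {t} → t ≢ u → ¬ Adjacent t u → lookup w t ≡ h (toℕ t)
      ∈Eq  : Eq n A w

  spread : ∀ λ₀ u → ∃[ w ] Spread w λ₀ u
  spread λ₀ u = tabulate letter , record { near = near ; far = far ; ∈Eq = ∈Eq }
    where
    near? : Decidable (λ t → t ≡ u ⊎ Adjacent t u)
    near? t = (t Fin.≟ u) ⊎-dec (consecutive? t u ⊎-dec consecutive? u t)

    letter : Fin n → A
    letter t with near? t
    ... | yes _ = λ₀
    ... | no  _ = h (toℕ t)

    near′ : ∀ {t} → t ≡ u ⊎ Adjacent t u → lookup (tabulate letter) t ≡ λ₀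
    near′ {t} p rewrite lookup∘tabulate letter t with near? t
    ... | yes _ = refl
    ... | no ¬p = contradiction p ¬p

    near : ∀ {t} → Adjacent t u → lookup (tabulate letter) t ≡ λ₀
    near = near′ ∘ inj₂

    far : ∀ {t} → t ≢ u → ¬ Adjacent t u → lookup (tabulate letter) t ≡ h (toℕ t)
    far {t} t≢u ¬tu rewrite lookup∘tabulate letter t with near? t
    ... | yes (inj₁ t≡u) = contradiction t≡u t≢u
    ... | yes (inj₂ tu)  = contradiction tu ¬tu
    ... | no _           = refl

    ∈Eq : Eq n A (tabulate letter)
    ∈Eq with neighbour 2≤n u
    ... | q , inj₁ uq = u , q , uq , trans (near′ (inj₁ refl)) (sym (near (inj₂ uq)))
    ... | q , inj₂ qu = q , u , qu , trans (near (inj₁ qu)) (sym (near′ (inj₁ refl)))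

  -- `copy` blocks the letter c t that t takes when the two inputs that met at t
  -- are glued; `spreading` blocks the letter ℓ t′ that was spread from t′ to t.
  -- Indexing c and ℓ by ℕ lets `unforbidden` ignore the ends of the word.
  data Forbidden (k : ℕ) (c ℓ : ℕ → A) (s : Fin n) : A → Set where
    colour₀   : Forbidden k c ℓ s h₀
    colour₁   : Forbidden k c ℓ s h₁
    copy      : ∀ {t} → Adjacent s t → k < ρ t → Forbidden k c ℓ s (c (toℕ t))
    spreading : ∀ {t t′} → Adjacent s t → Adjacent t t′ → k ≤ ρ t′ →
                Forbidden k c ℓ s (ℓ (toℕ t′))

  h-forbidden : ∀ {k c ℓ s} p → Forbidden k c ℓ s (h p)
  h-forbidden p with alternating-value h₀ h₁ p
  ... | inj₁ eq rewrite eq = colour₀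
  ... | inj₂ eq rewrite eq = colour₁

  -- Two colours, two neighbours to copy from and two positions at distance two give six letters;
  -- this is the source of the bound seven.
  unforbidden : ∀ {k} c ℓ u → ρ u < k →
                ∃[ λ₀ ] λ₀ ≢ h₀ × λ₀ ≢ h₁ × ¬ Forbidden k c ℓ u λ₀
  unforbidden {k} c ℓ u u<k with fresh eA 7≤a
    (h₀ ∷ h₁ ∷ c (suc (toℕ u)) ∷ c (toℕ u ∸ 1) ∷ ℓ (suc (suc (toℕ u))) ∷ ℓ (toℕ u ∸ 2) ∷ [])
  ... | λ₀ , new = λ₀ , new zero , new (suc zero) , λ λ∈ → allowed λ∈ refl
    where
    allowed : ∀ {x} → Forbidden k c ℓ u x → λ₀ ≢ x
    allowed colour₀ = new zero
    allowed colour₁ = new (suc zero)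
    allowed (copy ut _) with Adjacent-position ut
    ... | inj₁ eq rewrite eq = new (suc (suc zero))
    ... | inj₂ eq rewrite eq = new (suc (suc (suc zero)))
    -- A walk back to `u` itself is ruled out by rank.
    allowed (spreading {t′ = t′} ut tt′ k≤t′)
      with Adjacent²-position ut tt′ (λ { refl → ℕ.<⇒≱ u<k k≤t′ })
    ... | inj₁ eq rewrite eq = new (suc (suc (suc (suc zero))))
    ... | inj₂ eq rewrite eq = new (suc (suc (suc (suc (suc zero)))))

  -- Gluing inputs at a cut.

  Reads≤ Reads> : ℕ → Fin m → Set
  Reads≤ k j = ∃[ s ] ρ s ≤ k × j ∈ W s
  Reads> k j = ∃[ t ] k < ρ t × j ∈ W t

  reads≤? : ∀ k → Decidable (Reads≤ k)
  reads≤? k j = Fin.any? λ s → (ρ s ℕ.≤? k) ×-dec (j ∈? W s)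

  AgreeAcross : ℕ → Vec B m → Vec B m → Set
  AgreeAcross k x y = ∀ {j} → Reads≤ k j → Reads> k j → lookup x j ≡ lookup y j

  -- Shared coordinates follow `x`, so the letters below the cut are kept unconditionally; only
  -- those above need `AgreeAcross`.
  glueAt : ℕ → Vec B m → Vec B m → Fin m → B
  glueAt k x y j with reads≤? k j
  ... | yes _ = lookup x j
  ... | no  _ = lookup y j

  glue : ℕ → Vec B m → Vec B m → Vec B m
  glue k x y = tabulate (glueAt k x y)

  glue-≤ : ∀ {k} x y {j} → Reads≤ k j → lookup (glue k x y) j ≡ lookup x j
  glue-≤ {k} x y {j} r rewrite lookup∘tabulate (glueAt k x y) j with reads≤? k j
  ... | yes _ = refl
  ... | no ¬r = contradiction r ¬r

  glue-≰ : ∀ {k} x y {j} → ¬ Reads≤ k j → lookup (glue k x y) j ≡ lookup y j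
  glue-≰ {k} x y {j} ¬r rewrite lookup∘tabulate (glueAt k x y) j with reads≤? k j
  ... | yes r = contradiction r ¬r
  ... | no _  = refl

  f-glue-≤ : ∀ {k} x y {s} → ρ s ≤ k → lookup (f (glue k x y)) s ≡ lookup (f x) s
  f-glue-≤ x y {s} s≤k = determines s _ _ λ j∈ → glue-≤ x y (s , s≤k , j∈)

  f-glue-> : ∀ {k x y} → AgreeAcross k x y → ∀ {t} → k < ρ t →
             lookup (f (glue k x y)) t ≡ lookup (f y) t
  f-glue-> {k} {x} {y} agree {t} k<t = determines t _ _ agrees
    where
    agrees : Agree (W t) (glue k x y) y
    agrees {j} j∈ with reads≤? k j
    ... | yes r = trans (glue-≤ x y r) (agree r (t , k<t , j∈))
    ... | no ¬r = glue-≰ x y ¬r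

  -- The two ranks would differ by at least two. So changing an input below cut `k` is invisible
  -- across cut `suc k`.
  ¬reads≤∧far : ∀ {k j} → Reads≤ k j → ¬ Reads> (suc k) j
  ¬reads≤∧far (s , s≤k , j∈s) (t , 1+k<t , j∈t) =
    ℕ.<⇒≱ 1+k<t (ℕ.≤-trans (local j∈s j∈t) (s≤s s≤k))

  -- The invariant and its two ends.

  Clean : (Fin n → Set) → Vec A n → Set
  Clean R w = ∀ {s t} → R s → R t → Consecutive s t → lookup w s ≢ lookup w t

  -- Rank `k` is exempt from `Forbidden`, because `fx′-u` will control the letter there.
  Dirty : ℕ → (c ℓ : ℕ → A) → Vec B m → Set
  Dirty k c ℓ y = ∀ x → AgreeAcross k x y → Clean (λ s → ρ s ≤ k) (f x) →
                  ¬ (∀ {s} → ρ s < k → ¬ Forbidden k c ℓ s (lookup (f x) s))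

  State : ℕ → Set
  State k = ∃[ c ] ∃[ ℓ ] ∃ (Dirty k c ℓ)

  -- Every position lies below this cut, and a word of the language is never clean everywhere; hence
  -- any tables and input do.
  dirty-top : ∀ {k} → n ≤ suc k → ∀ c ℓ y → Dirty k c ℓ y
  dirty-top n≤1+k c ℓ y x _ clean _ =
    let s , t , st , eq = f∈Eq x in clean (below s) (below t) st eq
    where
    below : ∀ s → ρ s ≤ _
    below s = ℕ.≤-pred (ℕ.≤-trans (rank<n π s) n≤1+k)

  -- Only one position has rank 0 and none has less, so `y` refutes itself.
  ¬dirty-bottom : ∀ c ℓ y → ¬ Dirty 0 c ℓ y
  ¬dirty-bottom c ℓ y dirty = dirty y (λ _ _ → refl) clean λ ()
    where
    clean : Clean (λ s → ρ s ≤ 0) (f y)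
    clean s≤0 t≤0 st with rank-injective π (trans (ℕ.n≤0⇒n≡0 s≤0) (sym (ℕ.n≤0⇒n≡0 t≤0)))
    ... | refl = contradiction (sym st) ℕ.1+n≢n

  -- One step of the descent.

  module Step
    {u v : Fin n} (v≡1+u : ρ v ≡ suc (ρ u)) (c ℓ : ℕ → A) (y : Vec B m)
    (dirty : Dirty (suc (ρ u)) c ℓ y) (λ₀ : A) (λ₀≢h₀ : λ₀ ≢ h₀) (λ₀≢h₁ : λ₀ ≢ h₁)
    (λ₀-allowed : ¬ Forbidden (suc (ρ u)) c ℓ u λ₀)
    (w : Vec A n) (w-spread : Spread w λ₀ u) (x : Vec B m) (fx≡w : f x ≡ w)
    where

    open Spread w-spread

    k : ℕ
    k = ρ u

    λ₀≢h : ∀ p → λ₀ ≢ h p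
    λ₀≢h p e with alternating-value h₀ h₁ p
    ... | inj₁ eq = λ₀≢h₀ (trans e eq)
    ... | inj₂ eq = λ₀≢h₁ (trans e eq)

    adjacent? : ∀ t → Dec (Adjacent t u)
    adjacent? t = consecutive? t u ⊎-dec consecutive? u t

    above-≢ : ∀ {t} → k < ρ t → t ≢ u
    above-≢ k<t refl = ℕ.n≮n _ k<t

    -- All equalities of `w` involve `u`, which has rank `k`.
    w-clean : Clean (λ t → k < ρ t) w
    w-clean {s} {t} k<s k<t st eq with adjacent? s | adjacent? t
    ... | yes su | yes tu = ¬Adjacent-triangle st su tu
    ... | yes su | no ¬tu = λ₀≢h (toℕ t) (trans (sym (near su)) (trans eq (far (above-≢ k<t) ¬tu)))
    ... | no ¬su | yes tu = λ₀≢h (toℕ s) (trans (sym (near tu)) (trans (sym eq) (far (above-≢ k<s) ¬su)))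
    ... | no ¬su | no ¬tu = alternating-≢ h₀ h₁ h₀≢h₁ (toℕ s)
      (trans (sym (far (above-≢ k<s) ¬su))
        (trans eq (trans (far (above-≢ k<t) ¬tu) (cong h st))))

    -- This letter can be fixed before `x′` is known: of the coordinates that `v` reads, those also
    -- read below the cut are ones where `x′` must agree with `x`.
    c₀ : A
    c₀ = lookup (f (glue k x y)) v

    c′ ℓ′ : ℕ → A
    c′ = c [ toℕ v ↦ c₀ ]
    ℓ′ = ℓ [ toℕ u ↦ λ₀ ]

    toℕ-≢ : ∀ {s t : Fin n} → s ≢ t → toℕ s ≢ toℕ t
    toℕ-≢ s≢t = s≢t ∘ Fin.toℕ-injective

    -- The updates lose no forbidden letter: the ranks of `v` and `u` are too small for their old
    -- entries to have counted at `suc k`.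
    weaken : ∀ {s a′} → Forbidden (suc k) c ℓ s a′ → Forbidden k c′ ℓ′ s a′
    weaken colour₀ = colour₀
    weaken colour₁ = colour₁
    weaken {s} (copy {t} st 1+k<t) =
      subst (Forbidden k c′ ℓ′ s)
        (↦-minimal c c₀ (toℕ-≢ {v} λ { refl → ℕ.<⇒≢ 1+k<t (sym v≡1+u) }))
        (copy st (ℕ.<⇒≤ 1+k<t))
    weaken {s} (spreading {t} {t′} st tt′ k<t′) =
      subst (Forbidden k c′ ℓ′ s)
        (↦-minimal ℓ λ₀ (toℕ-≢ {u} λ { refl → ℕ.n≮n _ k<t′ }))
        (spreading st tt′ (ℕ.<⇒≤ k<t′))

    module _ (x′ : Vec B m) (agree : AgreeAcross k x′ x)
             (clean : Clean (λ s → ρ s ≤ k) (f x′))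
             (allowed : ∀ {s} → ρ s < k → ¬ Forbidden k c′ ℓ′ s (lookup (f x′) s))
             where

      z : Vec B m
      z = glue k x′ y

      z-agree : AgreeAcross (suc k) z y
      z-agree r≤ r> = glue-≰ x′ y λ r → ¬reads≤∧far r r>

      fz-v : lookup (f z) v ≡ c₀
      fz-v = determines v _ _ agrees
        where
        agrees : Agree (W v) z (glue k x y)
        agrees {j} j∈ with reads≤? k j
        ... | yes r = trans (glue-≤ x′ y r)
          (trans (agree r (v , ℕ.≤-reflexive (sym v≡1+u) , j∈)) (sym (glue-≤ x y r)))
        ... | no ¬r = trans (glue-≰ x′ y ¬r) (sym (glue-≰ x y ¬r))

      -- If `s` is not `u`, the letter at `t` is either `λ₀`, spread from `u` through `t`, or a
      -- colour; both are forbidden at `s`.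
      crossing : ∀ {s t} → ρ s ≤ k → k < ρ t → Adjacent s t →
                 lookup (f x′) s ≡ lookup w t → lookup (f x′) u ≡ λ₀
      crossing {s} {t} s≤k k<t st eq with ρ s ℕ.≟ k | adjacent? t
      ... | yes s≡k | _ with refl ← rank-injective π s≡k = trans eq (near (swap st))
      ... | no s≢k  | yes tu = contradiction
        (subst (Forbidden k c′ ℓ′ s)
          (trans (↦-updates ℓ (toℕ u) λ₀) (sym (trans eq (near tu))))
          (spreading st tu ℕ.≤-refl))
        (allowed (ℕ.≤∧≢⇒< s≤k s≢k))
      ... | no s≢k  | no ¬tu = contradiction
        (subst (Forbidden k c′ ℓ′ s) (sym (trans eq (far (above-≢ k<t) ¬tu))) (h-forbidden (toℕ t)))
        (allowed (ℕ.≤∧≢⇒< s≤k s≢k))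

      above : ∀ {t} → k < ρ t → lookup (f (glue k x′ x)) t ≡ lookup w t
      above {t} k<t = trans (f-glue-> agree k<t) (cong (λ w → lookup w t) fx≡w)

      -- The glued word has an equality, but `clean` excludes it below the cut and `w-clean` above,
      -- so it crosses.
      fx′-u : lookup (f x′) u ≡ λ₀
      fx′-u with f∈Eq (glue k x′ x)
      ... | s , t , st , eq with ρ s ℕ.≤? k | ρ t ℕ.≤? k
      ... | yes s≤k | yes t≤k = contradiction
        (trans (sym (f-glue-≤ x′ x s≤k)) (trans eq (f-glue-≤ x′ x t≤k)))
        (clean s≤k t≤k st)
      ... | yes s≤k | no  t≰k = crossing s≤k (ℕ.≰⇒> t≰k) (inj₁ st)
        (trans (sym (f-glue-≤ x′ x s≤k)) (trans eq (above (ℕ.≰⇒> t≰k))))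
      ... | no  s≰k | yes t≤k = crossing t≤k (ℕ.≰⇒> s≰k) (inj₂ st)
        (trans (sym (f-glue-≤ x′ x t≤k)) (trans (sym eq) (above (ℕ.≰⇒> s≰k))))
      ... | no  s≰k | no  t≰k = contradiction
        (trans (sym (above (ℕ.≰⇒> s≰k))) (trans eq (above (ℕ.≰⇒> t≰k))))
        (w-clean (ℕ.≰⇒> s≰k) (ℕ.≰⇒> t≰k) st)

      -- By `apart`, `u` is not a neighbour of `v`. Every other neighbour below the cut has rank
      -- less than `k`, where `copy` forbids `c₀`.
      new-≢ : ∀ {s} → ρ s ≤ k → Adjacent s v → lookup (f z) s ≢ lookup (f z) v
      new-≢ {s} s≤k sv eq = allowed (ℕ.≤∧≢⇒< s≤k s≢k)
        (subst (Forbidden k c′ ℓ′ s)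
          (trans (↦-updates c (toℕ v) c₀) (sym (trans (sym (f-glue-≤ x′ y s≤k)) (trans eq fz-v))))
          (copy sv (ℕ.≤-reflexive (sym v≡1+u))))
        where
        s≢k : ρ s ≢ k
        s≢k s≡k = apart sv (trans v≡1+u (cong suc (sym s≡k)))

      rank-case : ∀ {s} → ρ s ≤ suc k → ρ s ≤ k ⊎ s ≡ v
      rank-case s≤1+k with ℕ.m≤n⇒m<n∨m≡n s≤1+k
      ... | inj₁ s<1+k = inj₁ (ℕ.≤-pred s<1+k)
      ... | inj₂ s≡1+k = inj₂ (rank-injective π (trans s≡1+k (sym v≡1+u)))

      z-clean : Clean (λ s → ρ s ≤ suc k) (f z)
      z-clean s≤ t≤ st with rank-case s≤ | rank-case t≤
      ... | inj₁ s≤k  | inj₁ t≤k  = λ eq → clean s≤k t≤k st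
        (trans (sym (f-glue-≤ x′ y s≤k)) (trans eq (f-glue-≤ x′ y t≤k)))
      ... | inj₁ s≤k  | inj₂ refl = new-≢ s≤k (inj₁ st)
      ... | inj₂ refl | inj₁ t≤k  = ≢-sym (new-≢ t≤k (inj₂ st))
      ... | inj₂ refl | inj₂ refl = contradiction (sym st) ℕ.1+n≢n

      z-allowed : ∀ {s} → ρ s < suc k → ¬ Forbidden (suc k) c ℓ s (lookup (f z) s)
      z-allowed {s} s<1+k z∈ with ℕ.m≤n⇒m<n∨m≡n (ℕ.≤-pred s<1+k)
        | subst (Forbidden (suc k) c ℓ s) (f-glue-≤ x′ y (ℕ.≤-pred s<1+k)) z∈
      ... | inj₁ s<k | x′∈ = allowed s<k (weaken x′∈)
      ... | inj₂ s≡k | x′∈ with rank-injective π s≡k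
      ...   | refl = λ₀-allowed (subst (Forbidden (suc k) c ℓ u) fx′-u x′∈)

    dirty′ : Dirty k c′ ℓ′ x
    dirty′ x′ agree clean allowed =
      dirty (z x′ agree clean allowed) (z-agree x′ agree clean allowed)
        (z-clean x′ agree clean allowed) (z-allowed x′ agree clean allowed)

  step : ∀ k → suc k < n → State (suc k) → State k
  step k 1+k<n (c , ℓ , y , dirty)
    with atRank π (ℕ.<-trans (ℕ.n<1+n k) 1+k<n) | atRank π 1+k<n
  ... | u , refl | v , v≡1+u with unforbidden c ℓ u (ℕ.n<1+n (ρ u))
  ...   | λ₀ , λ₀≢h₀ , λ₀≢h₁ , λ₀-allowed with spread λ₀ u
  ...     | w , w-spread with Equivalence.to (image w) (Spread.∈Eq w-spread)
  ...       | x , fx≡w = c′ , ℓ′ , x , dirty′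
    where open Step v≡1+u c ℓ y dirty λ₀ λ₀≢h₀ λ₀≢h₁ λ₀-allowed w w-spread x fx≡w

  descend : ∀ k → k < n → State k → ⊥
  descend zero    _     (c , ℓ , y , dirty) = ¬dirty-bottom c ℓ y dirty
  descend (suc k) 1+k<n state = descend k (ℕ.<-trans (ℕ.n<1+n k) 1+k<n) (step k 1+k<n state)

  absurd : ⊥
  absurd = descend (n ∸ 1) (n∸1<n 2≤n)
    ((λ _ → h₀) , (λ _ → h₀) , y , dirty-top (ℕ.m≤n+m∸n n 1) _ _ y)
    where
    n∸1<n : ∀ {n} → 2 ≤ n → n ∸ 1 < n
    n∸1<n (s≤s _) = ℕ.n<1+n _

    -- `B` might be empty a priori; a word of the language supplies an input.
    y : Vec B m
    y with spread h₀ (proj₁ (atRank π (n∸1<n 2≤n)))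
    ... | w , w-spread = proj₁ (Equivalence.to (image w) (Spread.∈Eq w-spread))

-- Simplices of a path in terms of ranks.

module _ {n : ℕ} (P : Path n) where

  π : Permutation′ n
  π = Path.ordering P

  rank-Edge : ∀ {s t} → rank π t ≡ suc (rank π s) → Edge P (⁅ s ⁆ ∪ ⁅ t ⁆)
  rank-Edge {s} {t} eq = π ⟨$⟩ˡ s , π ⟨$⟩ˡ t , eq ,
    cong₂ (λ i j → ⁅ i ⁆ ∪ ⁅ j ⁆) (sym (inverseʳ π)) (sym (inverseʳ π))

  rank-vertex : ∀ i → rank π (Path.vertex P i) ≡ toℕ i
  rank-vertex i = cong toℕ (inverseˡ π)

  Simplex-ranks : ∀ {S s t} → Simplex (pathComplex P) S → s ∈ S → t ∈ S →
                  rank π t ≤ suc (rank π s)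
  Simplex-ranks (inj₁ refl) s∈ _ = contradiction s∈ ∉⊥
  Simplex-ranks (inj₂ (inj₁ (i , refl))) s∈ t∈
    rewrite x∈⁅y⁆⇒x≡y i s∈ | x∈⁅y⁆⇒x≡y i t∈ = ℕ.n≤1+n _
  Simplex-ranks {t = t} (inj₂ (inj₂ (i , j , ij , refl))) s∈ t∈ =
    ℕ.≤-trans (upper t∈) (s≤s (lower s∈))
    where
    ends : ∀ {r} → r ∈ ⁅ Path.vertex P i ⁆ ∪ ⁅ Path.vertex P j ⁆ →
           rank π r ≡ toℕ i ⊎ rank π r ≡ suc (toℕ i)
    ends r∈ with x∈p∪q⁻ ⁅ Path.vertex P i ⁆ ⁅ Path.vertex P j ⁆ r∈
    ... | inj₁ r∈i = inj₁ (trans (cong (rank π) (x∈⁅y⁆⇒x≡y _ r∈i)) (rank-vertex i))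
    ... | inj₂ r∈j = inj₂ (trans (cong (rank π) (x∈⁅y⁆⇒x≡y _ r∈j)) (trans (rank-vertex j) ij))

    lower : ∀ {r} → r ∈ ⁅ Path.vertex P i ⁆ ∪ ⁅ Path.vertex P j ⁆ → toℕ i ≤ rank π r
    lower r∈ with ends r∈
    ... | inj₁ eq = ℕ.≤-reflexive (sym eq)
    ... | inj₂ eq = ℕ.≤-trans (ℕ.n≤1+n _) (ℕ.≤-reflexive (sym eq))

    upper : ∀ {r} → r ∈ ⁅ Path.vertex P i ⁆ ∪ ⁅ Path.vertex P j ⁆ → rank π r ≤ suc (toℕ i)
    upper r∈ with ends r∈
    ... | inj₁ eq = ℕ.≤-trans (ℕ.≤-reflexive eq) (ℕ.n≤1+n _)
    ... | inj₂ eq = ℕ.≤-reflexive eq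

theorem4p1 : ∀ (A : Set) (a : ℕ) → A ↔ Fin a → 7 ≤ a →
    ∀ (n : ℕ) → 1 ≤ n →
    ∀ (P : Path n) → Generates (pathComplex P) (Eq n A) →
    ∃₂ λ i j → Consecutive i j × Edge P (⁅ i ⁆ ∪ ⁅ j ⁆)
theorem4p1 A a eA 7≤a n 1≤n P (B , b , eB , m , f , image , Kf⊑P)
  with Fin.any? (λ i → Fin.any? (λ j → consecutive? i j ×-dec
         (consecutive? (π P ⟨$⟩ˡ i) (π P ⟨$⟩ˡ j) ⊎-dec consecutive? (π P ⟨$⟩ˡ j) (π P ⟨$⟩ˡ i))))
... | yes (i , j , ij , inj₁ up)   = i , j , ij , rank-Edge P up
... | yes (i , j , ij , inj₂ down) =
  i , j , ij , subst (Edge P) (∪-comm ⁅ j ⁆ ⁅ i ⁆) (rank-Edge P down)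
... | no none = ⊥-elim
  (Descent.absurd eA 7≤a (Path.2≤n P) h₀ h₁ (λ eq → h₁-new zero (sym eq)) (π P) f image W (proj₁ ∘ window) local apart)
  where
  h₀ : A
  h₀ = proj₁ (fresh eA (ℕ.≤-trans (s≤s z≤n) 7≤a) [])

  another : ∃[ x ] ∀ i → x ≢ lookup (h₀ ∷ []) i
  another = fresh eA (ℕ.≤-trans (s≤s (s≤s z≤n)) 7≤a) (h₀ ∷ [])

  h₁ : A
  h₁ = proj₁ another

  h₁-new : ∀ i → h₁ ≢ lookup (h₀ ∷ []) i
  h₁-new = proj₂ another

  W : Fin n → Subset m
  W s = proj₁ (inputWindow eA eB f s)

  window : ∀ s → IsInputWindow f s (W s)
  window s = proj₂ (inputWindow eA eB f s)

  local : ∀ {s t j} → j ∈ W s → j ∈ W t → rank (π P) t ≤ suc (rank (π P) s)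
  -- The common coordinate `j` makes the pair a simplex of the communication complex, hence of the
  -- path.
  local {s} {t} {j} j∈s j∈t = Simplex-ranks P
    (Kf⊑P (⁅ s ⁆ ∪ ⁅ t ⁆) (λ _ → j , common)) s∈ t∈
    where
    s∈ : s ∈ ⁅ s ⁆ ∪ ⁅ t ⁆
    s∈ = x∈p∪q⁺ (inj₁ (x∈⁅x⁆ s))

    t∈ : t ∈ ⁅ s ⁆ ∪ ⁅ t ⁆
    t∈ = x∈p∪q⁺ (inj₂ (x∈⁅x⁆ t))

    common : ∀ {i} → i ∈ ⁅ s ⁆ ∪ ⁅ t ⁆ → InWindow f i j
    common i∈ with x∈p∪q⁻ ⁅ s ⁆ ⁅ t ⁆ i∈
    ... | inj₁ i∈s rewrite x∈⁅y⁆⇒x≡y s i∈s = W s , window s , j∈s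
    ... | inj₂ i∈t rewrite x∈⁅y⁆⇒x≡y t i∈t = W t , window t , j∈t

  apart : ∀ {s t} → Adjacent s t → rank (π P) t ≢ suc (rank (π P) s)
  apart (inj₁ st) eq = none (_ , _ , st , inj₁ eq)
  apart (inj₂ ts) eq = none (_ , _ , ts , inj₂ eq)
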